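{- $S_d(4,1)\le 3d$; that is, there is a search algorithm for $4$ robots, at most $1$ of which is byzantine faulty, whose search time for a target at (unknown) distance $d$ from the origin is at most $3d$, for every $d>0$.
   Context: Model. $n$ robots with distinct identities start at time $0$ at the origin of the real line and move along the line with speed at most $1$, changing direction or speed at no cost. A target lies at an unknown point at distance $d>0$ from the origin, i.e. at $d$ or $-d$, with $d$ unknown to the robots. At most $f$ robots are faulty; the bound $f$ is known, but not which robots are faulty. A search algorithm assigns each robot a trajectory, known to all robots; a robot's further motion may depend on the messages broadcast so far (computation and communication take no time). A robot detects whether the target is at a point only by being there. The only messages are announcements "the target is here", heard instantly by all robots at any distance; each message automatically carries the true identity and true current location of its sender. A robot visiting a point silently is taken to claim that the target is not there. Reliable (non-faulty) robots follow the algorithm and report truthfully. Faulty robots are controlled by an adversary: they may stay silent at the target or announce the target where it is not; a faulty robot that broadcasts while off its assigned trajectory is thereby detected as faulty. The search is completed at the first time when some reliable robot has visited the target and announced it and all reliable robots can be certain of its location (every scenario with at most $f$ faulty robots consistent with the messages so far has the target at that location). For an algorithm, the search time $S_d(n,f)$ is the worst-case completion time over both positions $\pm d$ of the target, all choices of at most $f$ faulty robots, and all behaviours of the faulty robots. The inequality $S_d(n,f)\le cd$ means that there is an algorithm, not depending on $d$, with search time at most $cd$ for every $d>0$. -}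

module Defs where

open import Algebra.Structures using (IsCommutativeRing)
open import Data.Fin using (Fin)
open import Data.Fin.Subset using (Subset; ∣_∣; _∈_; _∉_)
open import Data.List using (List; filter)
import Data.List.Membership.Propositional as List
open import Data.Nat as ℕ using (ℕ)
open import Data.Product using (Σ-syntax; ∃; ∃-syntax; _×_)
open import Data.Sum using (_⊎_)
open import Relation.Binary.PropositionalEquality using (_≡_; _≢_)
open import Relation.Binary.Structures using (IsDecTotalOrder)

-- The real numbers, axiomatised classically: a complete ordered field with a
-- decidable order.  It is unique up to isomorphism, so "for every
-- R : RealNumbers" means "over the real line".
record RealNumbers : Set₁ where
  infix  8 -_
  infixl 7 _*_
  infixl 6 _+_
  infix  4 _≤_
  field
    ℝ       : Set
    _+_ _*_ : ℝ → ℝ → ℝ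
    -_      : ℝ → ℝ
    0# 1#   : ℝ
    _≤_     : ℝ → ℝ → Set
    isCommutativeRing : IsCommutativeRing _≡_ _+_ _*_ -_ 0# 1#
    0≢1               : 0# ≢ 1#
    inverse           : ∀ x → x ≢ 0# → ∃[ y ] x * y ≡ 1#
    isDecTotalOrder   : IsDecTotalOrder _≡_ _≤_
    +-monoʳ-≤         : ∀ x {y z} → y ≤ z → x + y ≤ x + z
    *-nonNegative     : ∀ {x y} → 0# ≤ x → 0# ≤ y → 0# ≤ x * y

  UpperBound : (ℝ → Set) → ℝ → Set
  UpperBound P b = ∀ x → P x → x ≤ b

  field
    supremum : ∀ (P : ℝ → Set) → ∃ P → ∃ (UpperBound P) →
               ∃[ s ] (UpperBound P s × (∀ b → UpperBound P b → s ≤ b))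

  open IsCommutativeRing isCommutativeRing public using (_-_)
  open IsDecTotalOrder isDecTotalOrder public using (_≤?_)

  infix 4 _<_
  _<_ : ℝ → ℝ → Set
  x < y = x ≤ y × x ≢ y

  3# : ℝ
  3# = 1# + 1# + 1#

module LineSearch (R : RealNumbers) where

  open RealNumbers R

  -- A motion during times t ≥ 0; its values at negative times are irrelevant.
  -- The two inequalities say |p t - p s| ≤ t - s.
  Trajectory : (ℝ → ℝ) → Set
  Trajectory p = p 0# ≡ 0#
               × (∀ s t → 0# ≤ s → s ≤ t → p t - p s ≤ t - s × p s - p t ≤ t - s)

  -- The announcement "the target is here", with the true identity and the true
  -- location of its sender.
  record Message (n : ℕ) : Set where
    constructor message
    field
      sender : Fin n
      time   : ℝ
      place  : ℝ

  open Message public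

  Transcript : ℕ → Set
  Transcript n = List (Message n)

  infix 4 _∈ₜ_
  _∈ₜ_ : ∀ {n} → Message n → Transcript n → Set
  _∈ₜ_ = List._∈_

  heard : ∀ {n} → Transcript n → ℝ → Transcript n
  heard H t = filter (λ m → time m ≤? t) H

  -- The assigned position of a robot at time t is computed from the messages
  -- broadcast up to time t only.  By the speed limit, a message of time t cannot
  -- influence the position at time t itself, only later ones.
  record Algorithm (n : ℕ) : Set where
    field
      plan : Transcript n → Fin n → ℝ → ℝ

    position : Transcript n → Fin n → ℝ → ℝ
    position H i t = plan (heard H t) i t

    field
      trajectory : ∀ H i → Trajectory (position H i)

  module _ {n : ℕ} (A : Algorithm n) where

    open Algorithm A using (position)

    -- Robot i behaves in [0, τ] like a reliable robot when the target is at x: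
    -- it announces only at the target, while on its assigned trajectory, and
    -- whenever it is at the target it has announced it by then (so it announces
    -- at its first visit; repeating the announcement at later ones is optional).
    Reliable : Transcript n → ℝ → ℝ → Fin n → Set
    Reliable H τ x i =
        (∀ m → m ∈ₜ H → sender m ≡ i → time m ≤ τ →
           0# ≤ time m × place m ≡ x × position H i (time m) ≡ x)
      × (∀ t → 0# ≤ t → t ≤ τ → position H i t ≡ x →
           ∃[ m ] (m ∈ₜ H × sender m ≡ i × time m ≤ t))

    -- A faulty robot may leave its assigned trajectory and announce or stay
    -- silent at will, but it respects the speed limit and cannot forge the
    -- location attached to its messages.
    Faulty : Transcript n → ℝ → Fin n → Set
    Faulty H τ i =
      ∃[ q ] (Trajectory q ×
              (∀ m → m ∈ₜ H → sender m ≡ i → time m ≤ τ →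
                 0# ≤ time m × q (time m) ≡ place m))

    -- The messages of H up to time τ can arise when the target is at x and F is
    -- the set of faulty robots.
    record Scenario (f : ℕ) (H : Transcript n) (τ x : ℝ) (F : Subset n) : Set where
      field
        x≢0      : x ≢ 0#
        ∣F∣≤f    : ∣ F ∣ ℕ.≤ f
        reliable : ∀ i → i ∉ F → Reliable H τ x i
        faulty   : ∀ i → i ∈ F → Faulty H τ i

    Certain : ℕ → Transcript n → ℝ → ℝ → Set
    Certain f H t x = ∀ x′ F′ → Scenario f H t x′ F′ → x′ ≡ x

    -- Once this holds it holds at all later times.
    Completed : ℕ → Transcript n → ℝ → ℝ → Subset n → Set
    Completed f H t x F =
        (∃[ i ] ∃[ m ] (i ∉ F × m ∈ₜ H × sender m ≡ i × time m ≤ t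
                        × place m ≡ x × position H i (time m) ≡ x))
      × Certain f H t x

    -- In every run up to time τ with the target at distance d and at most f
    -- faulty robots, the search is completed no later than τ.
    SearchTime≤ : ℕ → ℝ → ℝ → Set
    SearchTime≤ f d τ =
      ∀ x → x ≡ d ⊎ x ≡ - d →
      ∀ F H → Scenario f H τ x F →
      ∃[ t ] (0# ≤ t × t ≤ τ × Completed f H t x F)

  -- S_d(n,f) ≤ c d
  S[_,_]≤_·d : ℕ → ℕ → ℝ → Set
  S[ n , f ]≤ c ·d =
    Σ[ A ∈ Algorithm n ] (∀ d → 0# < d → SearchTime≤ A f d (c * d))

{-# OPTIONS --safe #-}

-- Two robots go to each side at unit speed.  On each side one of them never
-- turns, and the other one reverses as soon as somebody of the other side makes
-- an announcement, so that it can check that place at three times its distance.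
-- Let the target be at distance d on side σ.
-- If the other side is silent before time d, both robots of side σ are at the
-- target at time d.  Either both announce it, or one of them is faulty; then the
-- other one's announcement has called back a reliable robot of the other side,
-- which confirms it by time 3d.
-- If somebody of the other side announces at a time s < d, he lies, so both
-- robots of side σ are reliable.  The one that does not turn announces the
-- target at time d.  To believe in another place one has to regard this robot as
-- the faulty one and the lie as true, hence the target as being at distance s on
-- the other side; but there the turning robot, reliable in both scenarios, has
-- been by time 3s ≤ 3d.
module Submission where

open import Defs
open import Algebra.Bundles using (CommutativeRing)
import Algebra.Properties.AbelianGroup
import Algebra.Solver.Ring.NaturalCoefficients.Default
open import Data.Fin using (Fin; zero; suc)
open import Data.Fin.Subset using (Subset; ∣_∣; _∈_; _∉_)
open import Data.Fin.Subset.Properties using (_∈?_; x∈p∧x≢y⇒x∈p-y; x∈p⇒∣p-x∣<∣p∣)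
open import Data.List.Base using (filter; map)
import Data.List.Extrema
open import Data.List.Membership.Propositional using (find; lose)
open import Data.List.Membership.Propositional.Properties
  using (∈-filter⁺; ∈-filter⁻; ∈-map∘filter⁺; ∈-map∘filter⁻)
open import Data.List.Relation.Unary.All using (lookup; tabulate)
open import Data.List.Relation.Unary.Any using (any?)
import Data.Nat as ℕ
import Data.Nat.Properties as ℕₚ
open import Data.Product using (∃-syntax; _×_; _,_; proj₁; proj₂)
open import Data.Sign using (Sign; opposite)
open import Data.Sign.Properties using (s≢opposite[s]) renaming (_≟_ to _≟ˢ_)
open import Data.Sum using (_⊎_; inj₁; inj₂)
open import Function using (_∘_)
open import Level using (0ℓ)
open import Relation.Binary.Bundles using (DecTotalOrder)
open import Relation.Binary.PropositionalEquality
  using (_≡_; _≢_; refl; sym; trans; cong; cong₂; subst; subst₂)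
open import Relation.Nullary using (¬_; Dec; yes; no; contradiction)
open import Relation.Nullary.Decidable using (_×-dec_; ¬?)

-- At most one fault, and the four robots by side and role.

∣p∣≤1⇒unique : ∀ {n} {p : Subset n} {i j} → ∣ p ∣ ℕ.≤ 1 → i ≢ j → i ∈ p → j ∉ p
∣p∣≤1⇒unique ∣p∣≤1 i≢j i∈p j∈p =
  ℕₚ.n≮0 (ℕₚ.<-≤-trans (x∈p⇒∣p-x∣<∣p∣ (x∈p∧x≢y⇒x∈p-y j∈p (i≢j ∘ sym)))
                        (ℕ.s≤s⁻¹ (ℕₚ.<-≤-trans (x∈p⇒∣p-x∣<∣p∣ i∈p) ∣p∣≤1)))

data Role : Set where
  stays turns : Role

robot : Sign → Role → Fin 4
robot Sign.+ stays = zero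
robot Sign.+ turns = suc zero
robot Sign.- stays = suc (suc zero)
robot Sign.- turns = suc (suc (suc zero))

side : Fin 4 → Sign
side zero             = Sign.+
side (suc zero)       = Sign.+
side (suc (suc _))    = Sign.-

role : Fin 4 → Role
role zero                   = stays
role (suc zero)             = turns
role (suc (suc zero))       = stays
role (suc (suc (suc zero))) = turns

side-robot : ∀ σ ρ → side (robot σ ρ) ≡ σ
side-robot Sign.+ stays = refl
side-robot Sign.+ turns = refl
side-robot Sign.- stays = refl
side-robot Sign.- turns = refl

role-robot : ∀ σ ρ → role (robot σ ρ) ≡ ρ
role-robot Sign.+ stays = refl
role-robot Sign.+ turns = refl
role-robot Sign.- stays = refl
role-robot Sign.- turns = refl

stays≢turns : ∀ {σ σ′} → robot σ stays ≢ robot σ′ turns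
stays≢turns {σ} {σ′} eq
  with () ← trans (sym (role-robot σ stays)) (trans (cong role eq) (role-robot σ′ turns))

sides≢ : ∀ {σ i j} → side i ≡ σ → side j ≡ opposite σ → i ≢ j
sides≢ refl opp refl = s≢opposite[s] _ opp

opposite-involutive : ∀ σ → opposite (opposite σ) ≡ σ
opposite-involutive Sign.+ = refl
opposite-involutive Sign.- = refl

module Search (R : RealNumbers) where

  open RealNumbers R
  open LineSearch R

  -- Arithmetic of the ordered field.

  commutativeRing : CommutativeRing 0ℓ 0ℓ
  commutativeRing = record { isCommutativeRing = isCommutativeRing }

  decTotalOrder : DecTotalOrder 0ℓ 0ℓ 0ℓ
  decTotalOrder = record { isDecTotalOrder = isDecTotalOrder }

  open CommutativeRing commutativeRing
    using (+-comm; +-assoc; +-identityˡ; +-identityʳ; -‿inverseˡ; -‿inverseʳ;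
           +-abelianGroup; commutativeSemiring)
  open DecTotalOrder decTotalOrder
    using (totalOrder; total)
    renaming (refl to ≤-refl; trans to ≤-trans; antisym to ≤-antisym)
  open Algebra.Properties.AbelianGroup +-abelianGroup
    using (inverseˡ-unique) renaming (⁻¹-involutive to neg-involutive; ε⁻¹≈ε to -0≡0)
  open Algebra.Solver.Ring.NaturalCoefficients.Default commutativeSemiring
    using (solve; _:+_; _:*_; _:=_; con)
  open Data.List.Extrema totalOrder using (min; min≤⊤; min≤xs; v≤min⁺)

  +-mono-≤ : ∀ {a b c d} → a ≤ b → c ≤ d → a + c ≤ b + d
  +-mono-≤ {a} {b} {c} {d} a≤b c≤d =
    ≤-trans (+-monoʳ-≤ a c≤d) (subst₂ _≤_ (+-comm d a) (+-comm d b) (+-monoʳ-≤ d a≤b))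

  add-sub : ∀ x y → x + y - y ≡ x
  add-sub x y = trans (+-assoc x y (- y)) (trans (cong (x +_) (-‿inverseʳ y)) (+-identityʳ x))

  sub-add : ∀ x y → x - y + y ≡ x
  sub-add x y = trans (+-assoc x (- y) y) (trans (cong (x +_) (-‿inverseˡ y)) (+-identityʳ x))

  +-cancelʳ-≤ : ∀ {a b} c → a + c ≤ b + c → a ≤ b
  +-cancelʳ-≤ {a} {b} c h = subst₂ _≤_ (add-sub a c) (add-sub b c) (+-mono-≤ h (≤-refl { - c}))

  -- A linear inequality follows from another one by a semiring identity; with
  -- no subtraction in it, the solver for natural coefficients applies.
  exchange-≤ : ∀ {a b l r} → a ≤ b → l + b ≡ a + r → l ≤ r
  exchange-≤ {a} {b} {l} {r} a≤b eq = +-cancelʳ-≤ b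
    (subst (l + b ≤_) (+-comm b r) (subst (_≤ b + r) (sym eq) (+-mono-≤ a≤b ≤-refl)))

  sub-≤-sub : ∀ {a b c d} → a + d ≤ c + b → a - b ≤ c - d
  sub-≤-sub {a} {b} {c} {d} h = exchange-≤
    (subst₂ _≤_ (cong (_+ d) (sym (sub-add a b))) (cong (_+ b) (sym (sub-add c d))) h)
    (solve 4 (λ x b y d → x :+ (y :+ d :+ b) := x :+ b :+ d :+ y) refl (a - b) b (c - d) d)

  triple : ∀ x → 3# * x ≡ x + x + x
  triple = solve 1 (λ x → (con 1 :+ con 1 :+ con 1) :* x := x :+ x :+ x) refl

  x≤triple : ∀ {x} → 0# ≤ x → x ≤ 3# * x
  x≤triple {x} 0≤x = subst₂ _≤_ (trans (+-identityʳ _) (+-identityʳ x)) (sym (triple x))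
    (+-mono-≤ (+-mono-≤ (≤-refl {x}) 0≤x) 0≤x)

  0≤sum₂ : ∀ {x y} → 0# ≤ x → 0# ≤ y → 0# ≤ x + y
  0≤sum₂ 0≤x 0≤y = subst (_≤ _) (+-identityʳ 0#) (+-mono-≤ 0≤x 0≤y)

  -- Reflection of the line and trajectories.

  signed : Sign → ℝ → ℝ
  signed Sign.+ x = x
  signed Sign.- x = - x

  signed-neg : ∀ σ x → signed σ (- x) ≡ signed (opposite σ) x
  signed-neg Sign.+ x = refl
  signed-neg Sign.- x = neg-involutive x

  signed-trajectory : ∀ σ {p} → Trajectory p → Trajectory (λ t → signed σ (p t))
  signed-trajectory Sign.+ tr = tr
  signed-trajectory Sign.- {p} (p0 , lip) =
    trans (cong -_ p0) -0≡0 ,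
    λ s t 0≤s s≤t → let (up , down) = lip s t 0≤s s≤t in
      subst (_≤ t - s) (sym (swap (p s) (p t))) down ,
      subst (_≤ t - s) (sym (swap (p t) (p s))) up
    where
    swap : ∀ a b → - b - - a ≡ a - b
    swap a b = trans (cong (- b +_) (neg-involutive a)) (+-comm (- b) a)

  trajectory-cong : ∀ {p q} → (∀ t → p t ≡ q t) → Trajectory p → Trajectory q
  trajectory-cong eq (p0 , lip) =
    trans (sym (eq 0#)) p0 ,
    λ s t 0≤s s≤t → subst₂ (λ a b → a - b ≤ t - s × b - a ≤ t - s) (eq t) (eq s) (lip s t 0≤s s≤t)

  distance≤time : ∀ σ {p d t} → Trajectory p → 0# ≤ t → p t ≡ signed σ d → d ≤ t
  distance≤time Sign.+ {p} {d} {t} (p0 , lip) 0≤t at =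
    subst₂ _≤_ (trans (cong₂ _-_ at p0) (x-0 d)) (x-0 t) (proj₁ (lip 0# t ≤-refl 0≤t))
    where
    x-0 : ∀ x → x - 0# ≡ x
    x-0 x = trans (cong (x +_) -0≡0) (+-identityʳ x)
  distance≤time Sign.- {p} {d} {t} tr 0≤t at =
    distance≤time Sign.+ (signed-trajectory Sign.- tr) 0≤t (trans (cong -_ at) (neg-involutive d))

  -- Alarms and the time of turning.

  Alarm : Sign → Message 4 → Set
  Alarm σ m = side (sender m) ≡ opposite σ × 0# ≤ time m

  alarm? : ∀ σ m → Dec (Alarm σ m)
  alarm? σ m = (side (sender m) ≟ˢ opposite σ) ×-dec (0# ≤? time m)

  opaque

    -- The first alarm if there is one by time t, and t otherwise; so a robot
    -- that has not turned yet is at turnTime + turnTime - t = t.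
    turnTime : Sign → Transcript 4 → ℝ → ℝ
    turnTime σ H t = min t (map time (filter (alarm? σ) H))

    turnTime≤now : ∀ {σ H t} → turnTime σ H t ≤ t
    turnTime≤now {σ} {H} {t} = min≤⊤ t (map time (filter (alarm? σ) H))

    turnTime≤alarm : ∀ {σ H m t} → m ∈ₜ H → Alarm σ m → turnTime σ H t ≤ time m
    turnTime≤alarm {σ} {H} {m} {t} m∈H alarm =
      lookup (min≤xs t (map time (filter (alarm? σ) H)))
             (∈-map∘filter⁺ time (alarm? σ) (m , m∈H , refl , alarm))

    -- With the two bounds above this makes `turnTime σ H t` the greatest lower bound of `t` and the
    -- alarm times; all its further properties follow from that.
    ≤turnTime : ∀ {σ H v t} → v ≤ t → (∀ m → m ∈ₜ H → Alarm σ m → v ≤ time m) →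
                v ≤ turnTime σ H t
    ≤turnTime {σ} {H} {v} v≤t v≤alarms =
      v≤min⁺ v≤t (tabulate λ y∈ → below (∈-map∘filter⁻ time (alarm? σ) y∈))
      where
      below : ∀ {y} → ∃[ m ] (m ∈ₜ H × y ≡ time m × Alarm σ m) → v ≤ y
      below (m , m∈H , refl , alarm) = v≤alarms m m∈H alarm

  module _ {σ : Sign} {H : Transcript 4} where

    -- The clause `0# ≤ time m` of `Alarm` serves this bound: the plan must start at the origin for
    -- every transcript, even one with messages of negative time.
    0≤turnTime : ∀ {t} → 0# ≤ t → 0# ≤ turnTime σ H t
    0≤turnTime 0≤t = ≤turnTime 0≤t λ _ _ → proj₂

    turnTime-mono : ∀ {s t} → s ≤ t → turnTime σ H s ≤ turnTime σ H t
    turnTime-mono s≤t = ≤turnTime (≤-trans turnTime≤now s≤t) λ _ → turnTime≤alarm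

    -- The value at `t`, lowered by `t - s`, is still below `s` and below every alarm time.
    turnTime-lipschitz : ∀ {s t} → s ≤ t → turnTime σ H t + s ≤ turnTime σ H s + t
    turnTime-lipschitz {s} {t} s≤t =
      subst (_≤ turnTime σ H s + t) (sub-add (u + s) t) (+-mono-≤ v≤u′ ≤-refl)
      where
      u = turnTime σ H t
      v≤u′ : u + s - t ≤ turnTime σ H s
      v≤u′ = ≤turnTime
        (exchange-≤ turnTime≤now (sub-add (u + s) t))
        λ _ m∈H alarm → ≤-trans (exchange-≤ s≤t (trans (sub-add (u + s) t) (+-comm u s)))
                                (turnTime≤alarm m∈H alarm)

    -- From `time m` on the alarm itself bounds the minimum, so the growing entry `t` has no more
    -- effect.
    turnTime-settled : ∀ {m t} → m ∈ₜ H → Alarm σ m → time m ≤ t →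
                       turnTime σ H t ≡ turnTime σ H (time m)
    turnTime-settled m∈H alarm m≤t =
      ≤-antisym (≤turnTime (turnTime≤alarm m∈H alarm) λ _ → turnTime≤alarm) (turnTime-mono m≤t)

  -- Alarms after `t` exceed `t`, which is itself an entry of the minimum, so leaving them out
  -- changes nothing. Hence positions can be computed from the full transcript.
  turnTime-heard : ∀ σ H t → turnTime σ (heard H t) t ≡ turnTime σ H t
  turnTime-heard σ H t = ≤-antisym
    (≤turnTime turnTime≤now λ m m∈H alarm → early m m∈H alarm (total (time m) t))
    (≤turnTime turnTime≤now λ _ m∈ → turnTime≤alarm (proj₁ (∈-filter⁻ (λ m → time m ≤? t) m∈)))
    where
    early : ∀ m → m ∈ₜ H → Alarm σ m → time m ≤ t ⊎ t ≤ time m → turnTime σ (heard H t) t ≤ time m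
    early m m∈H alarm (inj₁ m≤t) = turnTime≤alarm (∈-filter⁺ (λ m → time m ≤? t) m∈H m≤t) alarm
    early m m∈H alarm (inj₂ t≤m) = ≤-trans turnTime≤now t≤m

  -- The algorithm and its positions.

  advance : Role → Sign → Transcript 4 → ℝ → ℝ
  advance stays σ H t = t
  -- Outward for the time `u`, then back for `t - u`: this gives `u - (t - u)`.
  advance turns σ H t = turnTime σ H t + turnTime σ H t - t

  advance-heard : ∀ ρ σ H t → advance ρ σ (heard H t) t ≡ advance ρ σ H t
  advance-heard stays σ H t = refl
  advance-heard turns σ H t = cong (λ u → u + u - t) (turnTime-heard σ H t)

  -- For the turning robot, `u + u - t` has slopes between -1 and 1 because `u` has slopes between 0
  -- and 1: `turnTime-lipschitz` bounds the outward speed, `turnTime-mono` the return speed.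
  advance-trajectory : ∀ ρ σ H → Trajectory (advance ρ σ H)
  advance-trajectory stays σ H = refl , λ s t _ s≤t → ≤-refl , sub-≤-sub (+-mono-≤ s≤t s≤t)
  advance-trajectory turns σ H = start , λ s t _ s≤t →
    sub-≤-sub (faster s t (subst₂ _≤_
      (trans (double+ (u t) s) (cong (_+ (s + s)) (sym (w+t t))))
      (trans (double+ (u s) t) (cong (_+ (t + t)) (sym (w+t s))))
      (+-mono-≤ (turnTime-lipschitz s≤t) (turnTime-lipschitz s≤t)))) ,
    sub-≤-sub (subst₂ _≤_ (sym (w+t s)) (trans (sym (w+t t)) (+-comm (w t) t))
      (+-mono-≤ (turnTime-mono s≤t) (turnTime-mono s≤t)))
    where
    u w : ℝ → ℝ
    u = turnTime σ H
    w = advance turns σ H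
    w+t : ∀ t → w t + t ≡ u t + u t
    w+t t = sub-add (u t + u t) t
    double+ : ∀ x y → x + y + (x + y) ≡ x + x + (y + y)
    double+ = solve 2 (λ x y → x :+ y :+ (x :+ y) := x :+ x :+ (y :+ y)) refl
    faster : ∀ s t → w t + t + (s + s) ≤ w s + s + (t + t) → w t + s ≤ t + w s
    faster s t h = exchange-≤ h
      (solve 4 (λ a b s t → a :+ s :+ (b :+ s :+ (t :+ t)) := a :+ t :+ (s :+ s) :+ (t :+ b)) refl
        (w t) (w s) s t)
    u0 : u 0# ≡ 0#
    u0 = ≤-antisym turnTime≤now (0≤turnTime ≤-refl)
    start : w 0# ≡ 0#
    start = trans (cong (λ v → v + v - 0#) u0) (trans (cong (_- 0#) (+-identityʳ 0#)) (-‿inverseʳ 0#))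

  algorithm : Algorithm 4
  algorithm = record
    { plan = λ H i t → signed (side i) (advance (role i) (side i) H t)
    ; trajectory = λ H i → trajectory-cong
        (λ t → cong (signed (side i)) (sym (advance-heard (role i) (side i) H t)))
        (signed-trajectory (side i) (advance-trajectory (role i) (side i) H))
    }

  open Algorithm algorithm using (position; trajectory)

  position-robot : ∀ σ ρ H t → position H (robot σ ρ) t ≡ signed σ (advance ρ σ H t)
  position-robot σ ρ H t
    rewrite side-robot σ ρ | role-robot σ ρ = cong (signed σ) (advance-heard ρ σ H t)

  -- The bound is not strict, since an alarm at time `t` itself moves a robot only later.
  unalarmed : ∀ {i σ H t} → side i ≡ σ → (∀ m → m ∈ₜ H → Alarm σ m → t ≤ time m) →
              position H i t ≡ signed σ t
  unalarmed {i} {σ} {H} {t} refl t≤alarms =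
    cong (signed σ) (trans (advance-heard (role i) σ H t) (straight (role i)))
    where
    straight : ∀ ρ → advance ρ σ H t ≡ t
    straight stays = refl
    straight turns =
      trans (cong (λ u → u + u - t) (≤-antisym turnTime≤now (≤turnTime ≤-refl t≤alarms)))
            (add-sub t t)

  -- The robot goes out by `s ≤ e`, comes back by `s` and goes on by `e`, which takes `s + s + e`.
  return : ∀ σ {H m e} → m ∈ₜ H → Alarm σ m → time m ≤ e →
           ∃[ t ] (0# ≤ t × t ≤ 3# * e × position H (robot σ turns) t ≡ signed (opposite σ) e)
  return σ {H} {m} {e} m∈H alarm m≤e =
    t , 0≤sum₂ (0≤sum₂ 0≤s 0≤s) 0≤e
      , subst (t ≤_) (sym (triple e)) (+-mono-≤ (+-mono-≤ s≤e s≤e) ≤-refl)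
      , trans (position-robot σ turns H t) (trans (cong (signed σ) back) (signed-neg σ e))
    where
    s t : ℝ
    -- The first alarm decides, and it may precede `m`.
    s = turnTime σ H (time m)
    t = s + s + e
    0≤s : 0# ≤ s
    0≤s = 0≤turnTime (proj₂ alarm)
    s≤e : s ≤ e
    s≤e = ≤-trans turnTime≤now m≤e
    0≤e : 0# ≤ e
    0≤e = ≤-trans (proj₂ alarm) m≤e
    m≤t : time m ≤ t
    m≤t = ≤-trans m≤e (subst (_≤ t) (+-identityˡ e) (+-mono-≤ (0≤sum₂ 0≤s 0≤s) ≤-refl))
    cancel : ∀ a → a - (a + e) ≡ - e
    cancel a = inverseˡ-unique _ _
      (trans (solve 3 (λ a z e → a :+ z :+ e := a :+ e :+ z) refl a (- (a + e)) e)
             (-‿inverseʳ (a + e)))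
    back : advance turns σ H t ≡ - e
    back = trans (cong (λ u → u + u - t) (turnTime-settled m∈H alarm m≤t)) (cancel (s + s))

  -- Announcements and certainty.

  Announced : Transcript 4 → ℝ → ℝ → Fin 4 → Set
  -- Besides what `Completed` asks for, `0# ≤ time m` is kept so that the message can serve as an
  -- `Alarm`.
  Announced H t x i = ∃[ m ] (m ∈ₜ H × sender m ≡ i × time m ≤ t
                              × 0# ≤ time m × place m ≡ x × position H i (time m) ≡ x)

  announced-≤ : ∀ {H s t x i} → s ≤ t → Announced H s x i → Announced H t x i
  announced-≤ s≤t (m , m∈H , from , m≤s , rest) = m , m∈H , from , ≤-trans m≤s s≤t , rest

  announce : ∀ {H τ x t i} → Reliable algorithm H τ x i → 0# ≤ t → t ≤ τ →
             position H i t ≡ x → Announced H t x i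
  announce (honest , alert) 0≤t t≤τ at with alert _ 0≤t t≤τ at
  ... | m , m∈H , from , m≤t = m , m∈H , from , m≤t , honest m m∈H from (≤-trans m≤t t≤τ)

  announced-unique : ∀ {H τ x y i} → Reliable algorithm H τ x i → Announced H τ y i → x ≡ y
  announced-unique (honest , _) (m , m∈H , from , m≤τ , _ , place≡y , _) =
    trans (sym (proj₁ (proj₂ (honest m m∈H from m≤τ)))) place≡y

  -- No scenario can blame both `i` and `j`, and whichever it trusts fixes the target.
  certain₂ : ∀ {H τ x i j} → i ≢ j → Announced H τ x i → Announced H τ x j →
             Certain algorithm 1 H τ x
  certain₂ {i = i} i≢j aᵢ aⱼ x′ F′ S′ with i ∈? F′
  ... | no  i∉F′ = announced-unique (Scenario.reliable S′ _ i∉F′) aᵢ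
  ... | yes i∈F′ =
    announced-unique (Scenario.reliable S′ _ (∣p∣≤1⇒unique (Scenario.∣F∣≤f S′) i≢j i∈F′)) aⱼ

  completed : ∀ {H τ x F i} → i ∉ F → Announced H τ x i → Certain algorithm 1 H τ x →
              Completed algorithm 1 H τ x F
  completed i∉F (m , m∈H , from , m≤τ , _ , place≡x , at) certain =
    (_ , m , i∉F , m∈H , from , m≤τ , place≡x , at) , certain

  -- A run with the target at distance `d` on side `σ`.

  module Run {σ : Sign} {d : ℝ} (0≤d : 0# ≤ d) {F : Subset 4} {H : Transcript 4}
             (S : Scenario algorithm 1 H (3# * d) (signed σ d) F) where

    open Scenario S

    τ x : ℝ
    τ = 3# * d
    x = signed σ d

    others : ∀ {i j} → i ≢ j → i ∈ F → j ∉ F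
    others = ∣p∣≤1⇒unique ∣F∣≤f

    -- A reliable sender is at the target when it announces, and the speed limit keeps it away
    -- before time `d`.
    d≤announcement : ∀ {m} → m ∈ₜ H → sender m ∉ F → time m ≤ τ → d ≤ time m
    d≤announcement {m} m∈H honest m≤τ with reliable _ honest .proj₁ m m∈H refl m≤τ
    ... | 0≤m , _ , at = distance≤time σ (trajectory H (sender m)) 0≤m at

    ally : ∀ ρ → side (robot σ ρ) ≡ σ
    ally = side-robot σ

    opponent : ∀ ρ → side (robot (opposite σ) ρ) ≡ opposite σ
    opponent = side-robot (opposite σ)

    -- Case of an alarm from the other side before time `d`.

    module Alarmed {m : Message 4} (m∈H : m ∈ₜ H) (alarm : Alarm σ m) (d≰m : ¬ d ≤ time m) where

      s : ℝ
      s = time m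

      s≤d : s ≤ d
      s≤d with total s d
      ... | inj₁ s≤d = s≤d
      ... | inj₂ d≤s = contradiction d≤s d≰m

      s≤τ : s ≤ τ
      s≤τ = ≤-trans s≤d (x≤triple 0≤d)

      liar : sender m ∈ F
      liar with sender m ∈? F
      ... | yes p = p
      ... | no ¬p = contradiction (d≤announcement m∈H ¬p s≤τ) d≰m

      ally-reliable : ∀ {i} → side i ≡ σ → i ∉ F
      ally-reliable side≡ = others (sides≢ side≡ (proj₁ alarm) ∘ sym) liar

      -- Both robots of side `σ` are reliable, so they announce nothing before `d`, and the plan
      -- gives the liar no reason to turn by time `s`.
      no-earlier-alarm : ∀ n → n ∈ₜ H → Alarm (opposite σ) n → s ≤ time n
      no-earlier-alarm n n∈H (side≡ , _) with total s (time n)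
      ... | inj₁ s≤n = s≤n
      ... | inj₂ n≤s = contradiction
        (≤-trans (d≤announcement n∈H (ally-reliable (trans side≡ (opposite-involutive σ)))
                                 (≤-trans n≤s s≤τ)) n≤s) d≰m

      -- This is the assigned position; the liar may really be elsewhere, but a scenario that trusts
      -- it has to put the target here.
      liar-position : position H (sender m) s ≡ signed (opposite σ) s
      liar-position = unalarmed (proj₁ alarm) no-earlier-alarm

      stayer-announced : Announced H τ x (robot σ stays)
      stayer-announced = announced-≤ (x≤triple 0≤d)
        (announce (reliable _ (ally-reliable (ally stays))) 0≤d (x≤triple 0≤d)
                  (position-robot σ stays H d))

      certain : Certain algorithm 1 H τ x
      certain x′ F′ S′ with robot σ stays ∈? F′
      ... | no  A∉F′ = announced-unique (Scenario.reliable S′ _ A∉F′) stayer-announced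
      -- Blaming the stayer means trusting the liar, so `x′` is at distance `s` on the other side.
      -- The turning robot visits `x′` at time `t`; trusted in `S′`, it must have announced `x′`,
      -- but being reliable in `S` it announces only `x`.
      ... | yes A∈F′ with return σ m∈H alarm ≤-refl
      ...   | t , 0≤t , t≤3s , at = sym (announced-unique
                (reliable _ (ally-reliable (ally turns)))
                (announced-≤ t≤τ (announce (Scenario.reliable S′ _ (trusted stays≢turns))
                                           0≤t t≤τ (trans at claim))))
        where
        trusted : ∀ {i} → robot σ stays ≢ i → i ∉ F′
        trusted A≢i = ∣p∣≤1⇒unique (Scenario.∣F∣≤f S′) A≢i A∈F′
        claim : signed (opposite σ) s ≡ x′
        claim = trans (sym liar-position)
          (Scenario.reliable S′ _ (trusted (sides≢ (ally stays) (proj₁ alarm)))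
            .proj₁ m m∈H refl s≤τ .proj₂ .proj₂)
        t≤τ : t ≤ τ
        t≤τ = ≤-trans t≤3s (subst₂ _≤_ (sym (triple s)) (sym (triple d))
                                       (+-mono-≤ (+-mono-≤ s≤d s≤d) s≤d))

      completion : Completed algorithm 1 H τ x F
      completion = completed (ally-reliable (ally stays)) stayer-announced certain

    -- Case of no alarm from the other side before time `d`.

    module Unalarmed (d≤alarms : ∀ m → m ∈ₜ H → Alarm σ m → d ≤ time m) where

      ally-announced : ∀ {i} → side i ≡ σ → i ∉ F → Announced H d x i
      ally-announced side≡ i∉F =
        announce (reliable _ i∉F) 0≤d (x≤triple 0≤d) (unalarmed side≡ d≤alarms)

      -- The fault of `j` leaves the other side reliable, and the announcement of `i` is an alarm
      -- for that side; its turning robot becomes the second witness for `certain₂`.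
      verified : ∀ {i j} → side i ≡ σ → i ∉ F → side j ≡ σ → j ∈ F →
                 Completed algorithm 1 H τ x F
      verified {i} side-i i∉F side-j j∈F
        with ally-announced side-i i∉F
      ... | aᵢ@(m , m∈H , refl , m≤d , 0≤m , _)
        with return (opposite σ) m∈H (trans side-i (sym (opposite-involutive σ)) , 0≤m) m≤d
      ... | t , 0≤t , t≤τ , at = completed i∉F a′ (certain₂ (sides≢ side-i (opponent turns)) a′
          (announced-≤ t≤τ (announce (reliable _ (others (sides≢ side-j (opponent turns)) j∈F)) 0≤t t≤τ
            (trans at (cong (λ ρ → signed ρ d) (opposite-involutive σ))))))
        where
        a′ = announced-≤ (x≤triple 0≤d) aᵢ

      completion : Completed algorithm 1 H τ x F
      completion with robot σ stays ∈? F | robot σ turns ∈? F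
      ... | yes A∈F | _ = verified (ally turns) (others stays≢turns A∈F) (ally stays) A∈F
      ... | no A∉F | yes B∈F = verified (ally stays) A∉F (ally turns) B∈F
      ... | no A∉F | no B∉F =
        completed A∉F (at-τ stays A∉F) (certain₂ stays≢turns (at-τ stays A∉F) (at-τ turns B∉F))
        where
        at-τ : ∀ ρ → robot σ ρ ∉ F → Announced H τ x (robot σ ρ)
        at-τ ρ ∉F = announced-≤ (x≤triple 0≤d) (ally-announced (ally ρ) ∉F)

    completion : Completed algorithm 1 H τ x F
    -- The transcript is a finite list and the order is decidable, so the two cases can be told
    -- apart.
    completion with any? (λ m → alarm? σ m ×-dec ¬? (d ≤? time m)) H
    ... | yes early with m , m∈H , alarm , d≰m ← find early = Alarmed.completion m∈H alarm d≰m
    ... | no ¬early = Unalarmed.completion d≤alarms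
      where
      d≤alarms : ∀ m → m ∈ₜ H → Alarm σ m → d ≤ time m
      d≤alarms m m∈H alarm with d ≤? time m
      ... | yes d≤m = d≤m
      ... | no  d≰m = contradiction (lose m∈H (alarm , d≰m)) ¬early

  search : S[ 4 , 1 ]≤ 3# ·d
  -- The completion time supplied is always the deadline `3# * d` itself.
  search = algorithm , λ where
      d (0≤d , _) _ (inj₁ refl) F H S →
        3# * d , ≤-trans 0≤d (x≤triple 0≤d) , ≤-refl , Run.completion {Sign.+} 0≤d S
      d (0≤d , _) _ (inj₂ refl) F H S →
        3# * d , ≤-trans 0≤d (x≤triple 0≤d) , ≤-refl , Run.completion {Sign.-} 0≤d S

proposition1 : (R : RealNumbers) →
    let open RealNumbers R using (3#)
        open LineSearch R
    in S[ 4 , 1 ]≤ 3# ·d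
proposition1 R = Search.search R
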